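{- Let $\Pi_1$ and $\Pi_2$ be nested logic programs and $V=\mathrm{var}(\Pi_1\cup\Pi_2)$. Then: 1. $\Pi_1\equiv_o\Pi_2$ (ordinary equivalence) iff $\models\forall V'\big(\mathcal{S}[\Pi_1]\equiv\mathcal{S}[\Pi_2]\big)$; 2. $\Pi_1\equiv_u\Pi_2$ (uniform equivalence) iff $\models\forall V\,\forall V'\big((\hat\Pi_1\equiv\hat\Pi_2)\wedge\mathcal{M}[\hat\Pi_1,\hat\Pi_2]\wedge\mathcal{M}[\hat\Pi_2,\hat\Pi_1]\big)$; 3. $\Pi_1\equiv_s\Pi_2$ (strong equivalence) iff $\models\forall V\,\forall V'\big((V\le V')\supset(\tau[\hat\Pi_1]\equiv\tau[\hat\Pi_2])\big)$.
   Context: Formulas are built from atoms, $\top,\bot$, and $\neg,\wedge,\vee,\supset$; an expression is a formula without $\supset$; $\varphi\equiv\psi$ abbreviates $(\varphi\supset\psi)\wedge(\psi\supset\varphi)$. A finite set of formulas is identified with the conjunction of its elements (empty conjunction $=\top$). A classical interpretation is a set $I$ of atoms ($p$ true iff $p\in I$). Programs: a rule $r$ is a pair $H(r)\leftarrow B(r)$ of expressions; a (nested logic) program is a finite set of rules; a fact is a rule $p\leftarrow$ with $p$ an atom (i.e. with body $\top$); $\hat\Pi=\{B(r)\supset H(r)\mid r\in\Pi\}$; $\mathrm{var}(\Pi)$ is the set of atoms occurring in $\Pi$. A program is basic if it contains no $\neg$; $I$ is a model of a basic program iff it is a classical model of $\hat\Pi$. The reduct $\Pi^I$ is obtained from $\Pi$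 by replacing every occurrence of an expression $\neg\psi$ not in the scope of another negation by $\top$ if $\neg\psi$ is classically true under $I$, and by $\bot$ otherwise. $I$ is a stable model of $\Pi$ iff $I$ is a $\subseteq$-minimal model of $\Pi^I$. Equivalence notions: $\Pi_1\equiv_o\Pi_2$ iff they have the same stable models; $\Pi_1\equiv_u\Pi_2$ iff $\Pi_1\cup\Pi\equiv_o\Pi_2\cup\Pi$ for every program $\Pi$ containing facts only; $\Pi_1\equiv_s\Pi_2$ iff $\Pi_1\cup\Pi\equiv_o\Pi_2\cup\Pi$ for every program $\Pi$. Priming: for each atom $p$, $p'$ and $p''$ are globally new atoms; $\varphi'$ replaces every atom $p$ of $\varphi$ by $p'$ (likewise for sets of formulas); for a set $U$ of atoms, $U'=\{p'\mid p\in U\}$ and $U''=\{p''\mid p\in U\}$. QBFs extend propositional formulas by quantifiers over atoms: under $I$, $\forall p\,\Psi$ is true iff both $\Psi[p/\top]$ and $\Psi[p/\bot]$ are true, $\exists p\,\Psi$ iff at least one is. $\models\Phi$ means $\Phi$ is true under every interpretation. $\exists P\,\Phi$, $\forall P\,\Phi$ for a finite set $P$ of atoms quantify all atoms of $P$. For indexed sets $S=\{\varphi_i\}$, $T=\{\psi_i\}$ of $n$ formulas, $S\le T$ abbreviates $\bigwedge_i(\varphi_i\supset\psi_i)$ and $S<T$ abbreviates $(S\le T)\wedge\neg(T\le S)$; among $U,U',U''$ the atoms $p,p',p''$ are paired. Translation $\tau$: $\tau[\varphi]=\varphi$ if $\varphi$ is an atom, $\top$ or $\bot$; $\tau[\varphi_1\circ\varphi_2]=\tau[\varphi_1]\circ\tau[\varphi_2]$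 for $\circ\in\{\wedge,\vee\}$; $\tau[\neg\psi]=\neg\psi'$; $\tau[\varphi_1\supset\varphi_2]=(\tau[\varphi_1]\supset\tau[\varphi_2])\wedge(\varphi_1'\supset\varphi_2')$. $\tau''[\cdot]$ is obtained from $\tau[\cdot]$ by replacing each unprimed atom $v$ by $v''$. Encodings: for a program $\Pi$, $\mathcal{S}[\Pi]=\hat\Pi'\wedge\neg\exists U\big((U<U')\wedge\bigwedge_{r\in\Pi}(\tau[B(r)]\supset\tau[H(r)])\big)$, where $U=\mathrm{var}(\Pi)$; and, for $\{i,j\}=\{1,2\}$ and $V=\mathrm{var}(\Pi_1\cup\Pi_2)$, $$\mathcal{M}[\hat\Pi_i,\hat\Pi_j]=\big((V<V')\wedge\tau[\hat\Pi_i]\big)\supset\exists V''\big((V\le V'')\wedge(V''<V')\wedge\tau''[\hat\Pi_j]\big).$$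
   Formalization: In item 1 both encodings S[Π₁], S[Π₂] use the joint alphabet U = V instead of U = var(Πᵢ); with the latter the claim fails, e.g. for {p←} and {p←, q←q}, which have the same stable model but encodings that differ at {p', q'}. -}

module Defs where

import Data.Bool.Base as Bool
open Bool using (Bool; true; false; not; if_then_else_)
open import Data.List.Base using (List; []; _∷_; _++_; map; foldr; concatMap)
open import Data.List.Relation.Unary.All using (All)
open import Data.Product.Base using (_×_; ∃)
open import Function.Base using (_∘_)
open import Function.Bundles using (_⇔_)
open import Relation.Binary.Definitions using (DecidableEquality)
open import Relation.Binary.PropositionalEquality using (_≡_; refl; cong)
open import Relation.Nullary.Decidable using (yes; no; map′; does)

private
  variable
    A C : Set

infix  9 ¬_
infixr 7 _∧_
infixr 6 _∨_
infixr 5 _⊃_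
infix  4 _≣_

------------------------------------------------------------------------
-- Syntax

data Formula (A : Set) : Set where
  atom        : A → Formula A
  ⊤ ⊥         : Formula A
  ¬_          : Formula A → Formula A
  _∧_ _∨_ _⊃_ : Formula A → Formula A → Formula A

-- Formulas without ⊃.
data Expr (A : Set) : Set where
  atom    : A → Expr A
  ⊤ ⊥     : Expr A
  ¬_      : Expr A → Expr A
  _∧_ _∨_ : Expr A → Expr A → Expr A

⌜_⌝ : Expr A → Formula A
⌜ atom p ⌝ = atom p
⌜ ⊤ ⌝      = ⊤
⌜ ⊥ ⌝      = ⊥
⌜ ¬ φ ⌝    = ¬ ⌜ φ ⌝
⌜ φ ∧ ψ ⌝  = ⌜ φ ⌝ ∧ ⌜ ψ ⌝
⌜ φ ∨ ψ ⌝  = ⌜ φ ⌝ ∨ ⌜ ψ ⌝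

⋀ : List (Formula A) → Formula A
⋀ = foldr _∧_ ⊤

rename : (A → C) → Formula A → Formula C
rename f (atom p) = atom (f p)
rename f ⊤        = ⊤
rename f ⊥        = ⊥
rename f (¬ φ)    = ¬ rename f φ
rename f (φ ∧ ψ)  = rename f φ ∧ rename f ψ
rename f (φ ∨ ψ)  = rename f φ ∨ rename f ψ
rename f (φ ⊃ ψ)  = rename f φ ⊃ rename f ψ

-- A finite set of atoms is a list; order and repetitions are irrelevant to
-- every use made of it below.
atoms : Formula A → List A
atoms (atom p) = p ∷ []
atoms ⊤        = []
atoms ⊥        = []
atoms (¬ φ)    = atoms φ
atoms (φ ∧ ψ)  = atoms φ ++ atoms ψ
atoms (φ ∨ ψ)  = atoms φ ++ atoms ψ
atoms (φ ⊃ ψ)  = atoms φ ++ atoms ψ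

------------------------------------------------------------------------
-- Interpretations

-- A set of atoms is given by its characteristic function, so that classical
-- truth is decided.
Interp : Set → Set
Interp A = A → Bool

_⊆_ : Interp A → Interp A → Set
I ⊆ J = ∀ p → I p ≡ true → J p ≡ true

eval : Interp A → Formula A → Bool
eval I (atom p) = I p
eval I ⊤        = true
eval I ⊥        = false
eval I (¬ φ)    = not (eval I φ)
eval I (φ ∧ ψ)  = eval I φ Bool.∧ eval I ψ
eval I (φ ∨ ψ)  = eval I φ Bool.∨ eval I ψ
eval I (φ ⊃ ψ)  = not (eval I φ) Bool.∨ eval I ψ

------------------------------------------------------------------------
-- Nested logic programs

infix 4 _←_

record Rule (A : Set) : Set where
  constructor _←_
  field
    H B : Expr A

open Rule public

-- Finite sets of rules as lists; union is _++_.
Program : Set → Set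
Program A = List (Rule A)

hat : Program A → Formula A
hat = ⋀ ∘ map (λ r → ⌜ B r ⌝ ⊃ ⌜ H r ⌝)

var : Program A → List A
var = concatMap (λ r → atoms ⌜ H r ⌝ ++ atoms ⌜ B r ⌝)

IsFact : Rule A → Set
IsFact r = ∃ λ p → r ≡ (atom p ← ⊤)

reductᵉ : Interp A → Expr A → Expr A
reductᵉ I (atom p) = atom p
reductᵉ I ⊤        = ⊤
reductᵉ I ⊥        = ⊥
reductᵉ I (¬ ψ)    = if eval I (¬ ⌜ ψ ⌝) then ⊤ else ⊥
reductᵉ I (φ ∧ ψ)  = reductᵉ I φ ∧ reductᵉ I ψ
reductᵉ I (φ ∨ ψ)  = reductᵉ I φ ∨ reductᵉ I ψ

reduct : Interp A → Program A → Program A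
reduct I = map (λ r → reductᵉ I (H r) ← reductᵉ I (B r))

-- Only applied to reducts, which contain no negation.
Model : Program A → Interp A → Set
Model Π I = eval I (hat Π) ≡ true

Stable : Program A → Interp A → Set
Stable Π I = Model (reduct I Π) I
           × (∀ J → Model (reduct I Π) J → J ⊆ I → I ⊆ J)

infix 4 _≡ₒ_ _≡ᵤ_ _≡ₛ_

_≡ₒ_ : Program A → Program A → Set
Π₁ ≡ₒ Π₂ = ∀ I → Stable Π₁ I ⇔ Stable Π₂ I

_≡ᵤ_ : Program A → Program A → Set
Π₁ ≡ᵤ Π₂ = ∀ Π → All IsFact Π → Π₁ ++ Π ≡ₒ Π₂ ++ Π

_≡ₛ_ : Program A → Program A → Set
Π₁ ≡ₛ Π₂ = ∀ Π → Π₁ ++ Π ≡ₒ Π₂ ++ Π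

------------------------------------------------------------------------
-- Quantified Boolean formulas

infixr 3 ∀[_]_ ∃[_]_ ∀⋆[_]_ ∃⋆[_]_

data QBF (A : Set) : Set where
  atom        : A → QBF A
  ⊤ ⊥         : QBF A
  ¬_          : QBF A → QBF A
  _∧_ _∨_ _⊃_ : QBF A → QBF A → QBF A
  ∀[_]_ ∃[_]_ : A → QBF A → QBF A

embed : Formula A → QBF A
embed (atom p) = atom p
embed ⊤        = ⊤
embed ⊥        = ⊥
embed (¬ φ)    = ¬ embed φ
embed (φ ∧ ψ)  = embed φ ∧ embed ψ
embed (φ ∨ ψ)  = embed φ ∨ embed ψ
embed (φ ⊃ ψ)  = embed φ ⊃ embed ψ

_≣_ : QBF A → QBF A → QBF A
Φ ≣ Ψ = (Φ ⊃ Ψ) ∧ (Ψ ⊃ Φ)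

∀⋆[_]_ ∃⋆[_]_ : List A → QBF A → QBF A
∀⋆[ P ] Φ = foldr ∀[_]_ Φ P
∃⋆[ P ] Φ = foldr ∃[_]_ Φ P

constant : Bool → QBF A
constant true  = ⊤
constant false = ⊥

module Truth (_≟_ : DecidableEquality A) where

  infix 8 _[_/_]
  infix 2 _⊢_⇓_
  infix 4 ⊨_

  -- Replaces the free occurrences of an atom by a truth constant.
  _[_/_] : QBF A → A → Bool → QBF A
  atom q     [ p / b ] = if does (p ≟ q) then constant b else atom q
  ⊤          [ p / b ] = ⊤
  ⊥          [ p / b ] = ⊥
  (¬ Φ)      [ p / b ] = ¬ (Φ [ p / b ])
  (Φ ∧ Ψ)    [ p / b ] = Φ [ p / b ] ∧ Ψ [ p / b ]
  (Φ ∨ Ψ)    [ p / b ] = Φ [ p / b ] ∨ Ψ [ p / b ]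
  (Φ ⊃ Ψ)    [ p / b ] = Φ [ p / b ] ⊃ Ψ [ p / b ]
  (∀[ q ] Φ) [ p / b ] = ∀[ q ] (if does (p ≟ q) then Φ else Φ [ p / b ])
  (∃[ q ] Φ) [ p / b ] = ∃[ q ] (if does (p ≟ q) then Φ else Φ [ p / b ])

  -- I ⊢ Φ ⇓ b: the truth value of Φ under I is b.  A relation rather than a
  -- function because substitution instances are not structurally smaller.
  data _⊢_⇓_ (I : Interp A) : QBF A → Bool → Set where
    atom : ∀ {p} → I ⊢ atom p ⇓ I p
    ⊤    : I ⊢ ⊤ ⇓ true
    ⊥    : I ⊢ ⊥ ⇓ false
    ¬_   : ∀ {Φ b} → I ⊢ Φ ⇓ b → I ⊢ ¬ Φ ⇓ not b
    _∧_  : ∀ {Φ Ψ b c} → I ⊢ Φ ⇓ b → I ⊢ Ψ ⇓ c → I ⊢ Φ ∧ Ψ ⇓ b Bool.∧ c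
    _∨_  : ∀ {Φ Ψ b c} → I ⊢ Φ ⇓ b → I ⊢ Ψ ⇓ c → I ⊢ Φ ∨ Ψ ⇓ b Bool.∨ c
    _⊃_  : ∀ {Φ Ψ b c} → I ⊢ Φ ⇓ b → I ⊢ Ψ ⇓ c → I ⊢ Φ ⊃ Ψ ⇓ not b Bool.∨ c
    ∀[]  : ∀ {p Φ b c} → I ⊢ Φ [ p / true ] ⇓ b → I ⊢ Φ [ p / false ] ⇓ c →
           I ⊢ ∀[ p ] Φ ⇓ b Bool.∧ c
    ∃[]  : ∀ {p Φ b c} → I ⊢ Φ [ p / true ] ⇓ b → I ⊢ Φ [ p / false ] ⇓ c →
           I ⊢ ∃[ p ] Φ ⇓ b Bool.∨ c

  ⊨_ : QBF A → Set
  ⊨ Φ = ∀ I → I ⊢ Φ ⇓ true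

------------------------------------------------------------------------
-- Primed alphabets

-- p ° is the atom p itself; p ′ and p ″ are its two fresh copies.
data Primed (A : Set) : Set where
  _° _′ _″ : A → Primed A

primed-≟ : DecidableEquality A → DecidableEquality (Primed A)
primed-≟ _≟_ (p °) (q °) = map′ (cong _°) (λ { refl → refl }) (p ≟ q)
primed-≟ _≟_ (p °) (q ′) = no λ ()
primed-≟ _≟_ (p °) (q ″) = no λ ()
primed-≟ _≟_ (p ′) (q °) = no λ ()
primed-≟ _≟_ (p ′) (q ′) = map′ (cong _′) (λ { refl → refl }) (p ≟ q)
primed-≟ _≟_ (p ′) (q ″) = no λ ()
primed-≟ _≟_ (p ″) (q °) = no λ ()
primed-≟ _≟_ (p ″) (q ′) = no λ ()
primed-≟ _≟_ (p ″) (q ″) = map′ (cong _″) (λ { refl → refl }) (p ≟ q)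

-- V ⟨ f ≤ g ⟩ compares the sets { f v ∣ v ∈ V } and { g v ∣ v ∈ V }, both
-- indexed by V; for instance V ⟨ _° ≤ _′ ⟩ is V ≤ V'.
_⟨_≤_⟩ _⟨_<_⟩ : List A → (A → C) → (A → C) → Formula C
V ⟨ f ≤ g ⟩ = ⋀ (map (λ v → atom (f v) ⊃ atom (g v)) V)
V ⟨ f < g ⟩ = V ⟨ f ≤ g ⟩ ∧ ¬ (V ⟨ g ≤ f ⟩)

------------------------------------------------------------------------
-- Translation and encodings

τ : Formula A → Formula (Primed A)
τ (atom p) = atom (p °)
τ ⊤        = ⊤
τ ⊥        = ⊥
τ (¬ φ)    = ¬ rename _′ φ
τ (φ ∧ ψ)  = τ φ ∧ τ ψ
τ (φ ∨ ψ)  = τ φ ∨ τ ψ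
τ (φ ⊃ ψ)  = (τ φ ⊃ τ ψ) ∧ (rename _′ φ ⊃ rename _′ ψ)

τ″ : Formula A → Formula (Primed A)
τ″ = rename (λ { (p °) → p ″ ; (p ′) → p ′ ; (p ″) → p ″ }) ∘ τ

-- The alphabet U is a parameter.  When two programs are compared, both
-- encodings must range over their joint alphabet: with U = var Π, the programs
-- {p ←} and {p ← , q ← q} have the same stable model {p}, but the encoding of
-- the first does not mention q′ and so also holds at {p′ , q′}, where that of
-- the second fails.
𝒮 : List A → Program A → QBF (Primed A)
𝒮 U Π = embed (rename _′ (hat Π))
      ∧ ¬ (∃⋆[ map _° U ] embed
             (U ⟨ _° < _′ ⟩ ∧ ⋀ (map (λ r → τ ⌜ B r ⌝ ⊃ τ ⌜ H r ⌝) Π)))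

ℳ : List A → Formula A → Formula A → QBF (Primed A)
ℳ V φ ψ = embed (V ⟨ _° < _′ ⟩ ∧ τ φ)
        ⊃ (∃⋆[ map _″ V ] embed
             (V ⟨ _° ≤ _″ ⟩ ∧ V ⟨ _″ < _′ ⟩ ∧ τ″ ψ))

{-# OPTIONS --safe #-}
module Submission where

-- Write X ⊩[ Y ] Π when X is a model of the reduct of Π with respect to Y.
-- Under an interpretation giving the atoms p the values X and the atoms p′ the
-- values Y, an expression translated by τ has the value under X of its reduct
-- with respect to Y (eval-τ), because τ sends a negation to the primed
-- alphabet.  Hence τ applied to the rules of Π expresses X ⊩[ Y ] Π, and τ
-- applied to hat Π expresses in addition that Y is a model of Π; such (X , Y)
-- are called SE pairs below.  The QBFs are read through a Boolean-valued
-- semantics equivalent to evaluation by substitution (⇓⇔⟦⟧), in which a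
-- quantifier block ranges over the interpretations that differ only on the
-- quantified atoms (⊨∀⋆, ∃⋆-true).  It remains to characterise the three
-- equivalences semantically, on the finite alphabet V.
--
-- Ordinary equivalence.  The encoding of Π says that Y is a model of Π and that
-- no X strictly below Y on V satisfies the reduct.  The interpretation Y is
-- stable iff this holds and Y is contained in V (Stable⇔StableOn), and off V
-- the encoding is insensitive to Y.
--
-- Strong equivalence amounts to equality of the SE pairs X ≤ Y.  Given the same
-- SE pairs, adding any program preserves stable models.  Conversely, let X ≤ Y
-- be an SE pair of Π₁ only.  Adding Y as facts makes Y stable, so Y is a model
-- of both programs.  Now add X as facts and a rule p ← q for all p in Y and q
-- not in X: a model of the extension below Y is X or Y on V.  As X does not
-- satisfy the reduct of Π₂, Y is stable for the extended Π₂, but X prevents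
-- this for Π₁ (≡ₛ⇒SE).
--
-- Uniform equivalence.  As before, both programs have the same models.  If
-- X < Y is an SE pair of Π₁, then Y is not stable for Π₁ together with the
-- facts X; so it is not stable for Π₂ with these facts, and this yields Z with
-- X ≤ Z < Y forming an SE pair of Π₂ with Y (≡ᵤ⇒interpolant).  Conversely, if
-- a J below Y refutes the stability of Y for Π₂ with some facts, then J and Y
-- agree on V, or an interpolant Z exists for Π₁; either way stability of Y for
-- Π₁ with the same facts fails (≡ᵤ-from).
--
-- Constructively, an interpolant is first obtained only under a double
-- negation.  This suffices, since its existence is the truth of a QBF, which
-- is decided by the Boolean-valued semantics.

import Data.Bool.Base as Bool
open Bool using (Bool; true; false; not; if_then_else_)
open import Data.Bool.Properties using (⇔→≡; ¬-not)
  renaming (_≟_ to _≟ᵇ_)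
open import Data.List.Base
  using (List; []; _∷_; _++_; map; filter; cartesianProductWith)
open import Data.List.Properties using (concatMap-++)
open import Data.List.Membership.Propositional using (_∈_; _∉_; lose)
open import Data.List.Membership.Propositional.Properties
  using ( ∈-map⁺; ∈-map⁻; ∈-++⁺ˡ; ∈-++⁺ʳ; ∈-++⁻; ∈-filter⁺; ∈-filter⁻
        ; ∈-cartesianProductWith⁺; ∈-cartesianProductWith⁻; ∈-concatMap⁺)
import Data.List.Membership.DecPropositional as DecMembership
open import Data.List.Relation.Binary.Subset.Propositional
  renaming (_⊆_ to _⊆ˡ_) using ()
open import Data.List.Relation.Unary.All as All using (All; all?)
open import Data.List.Relation.Unary.Any using (here; there)
open import Data.Product.Base using (_×_; ∃; _,_; proj₁; proj₂)
open import Data.Product.Function.NonDependent.Propositional using (_×-⇔_)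
open import Data.Sum.Base using (_⊎_; inj₁; inj₂; [_,_]′)
open import Function.Base using (_∘_; const; id; case_of_)
open import Function.Bundles using (_⇔_; mk⇔; module Equivalence)
open import Function.Properties.Equivalence
  renaming (refl to ⇔-refl; sym to ⇔-sym; trans to ⇔-trans) using ()
open import Function.Related.TypeIsomorphisms using (→-cong-⇔; ¬-cong-⇔)
open import Relation.Binary.Definitions using (DecidableEquality)
open import Relation.Binary.PropositionalEquality
  using (_≡_; _≗_; refl; sym; trans; cong; cong₂; subst; module ≡-Reasoning)
open import Relation.Nullary.Decidable
  using (Dec; yes; no; does; _→-dec_; decidable-stable; dec-true; dec-false)
  renaming (map to Dec-map)
import Relation.Nullary.Negation.Core as Neg
open import Defs
open Equivalence using (to; from)

private
  variable
    A C : Set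

-- Truth of Boolean connectives

∧-true : ∀ a b → a Bool.∧ b ≡ true ⇔ (a ≡ true × b ≡ true)
∧-true true  b = mk⇔ (refl ,_) proj₂
∧-true false b = mk⇔ (λ ()) (λ { (() , _) })

∨-true : ∀ a b → a Bool.∨ b ≡ true ⇔ (a ≡ true ⊎ b ≡ true)
∨-true true  b = mk⇔ inj₁ (const refl)
∨-true false b = mk⇔ inj₂ (λ { (inj₂ p) → p ; (inj₁ ()) })

⊃-true : ∀ a b → not a Bool.∨ b ≡ true ⇔ (a ≡ true → b ≡ true)
⊃-true true  b = mk⇔ const (λ f → f refl)
⊃-true false b = mk⇔ (λ _ ()) (const refl)

not-true : ∀ a → not a ≡ true ⇔ (Neg.¬ (a ≡ true))
not-true true  = mk⇔ (λ ()) (λ f → Neg.contradiction refl f)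
not-true false = mk⇔ (λ _ ()) (const refl)

≣-true : ∀ a b → (not a Bool.∨ b) Bool.∧ (not b Bool.∨ a) ≡ true
               ⇔ (a ≡ true ⇔ b ≡ true)
≣-true a b = ⇔-trans (∧-true _ _) (⇔-trans (⊃-true a b ×-⇔ ⊃-true b a)
  (mk⇔ (λ (f , g) → mk⇔ f g) (λ e → to e , from e)))

⋀-true : ∀ {B : Set} (I : Interp A) (f : B → Formula A) xs →
         eval I (⋀ (map f xs)) ≡ true ⇔ (∀ x → x ∈ xs → eval I (f x) ≡ true)
⋀-true I f []       = mk⇔ (λ _ _ ()) (const refl)
⋀-true I f (x ∷ xs) = ⇔-trans (∧-true _ _) (⇔-trans (⇔-refl ×-⇔ ⋀-true I f xs)
  (mk⇔ (λ { (p , ps) _ (here refl) → p ; (p , ps) y (there y∈) → ps y y∈ })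
       (λ ps → ps x (here refl) , λ y y∈ → ps y (there y∈))))

-- Denotational semantics of quantified Boolean formulas

module QBFSemantics {C : Set} (_≟_ : DecidableEquality C) where
  open Truth _≟_

  private
    variable
      I J : Interp C

  -- I with the value of p changed to b.
  _[_≔_] : Interp C → C → Bool → Interp C
  (I [ p ≔ b ]) q = if does (p ≟ q) then b else I q

  -- The truth value of a QBF, a quantifier changing the interpretation
  -- instead of being instantiated in its body.
  ⟦_⟧ : QBF C → Interp C → Bool
  ⟦ atom p ⟧   I = I p
  ⟦ ⊤ ⟧        I = true
  ⟦ ⊥ ⟧        I = false
  ⟦ ¬ Φ ⟧      I = not (⟦ Φ ⟧ I)
  ⟦ Φ ∧ Ψ ⟧    I = ⟦ Φ ⟧ I Bool.∧ ⟦ Ψ ⟧ I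
  ⟦ Φ ∨ Ψ ⟧    I = ⟦ Φ ⟧ I Bool.∨ ⟦ Ψ ⟧ I
  ⟦ Φ ⊃ Ψ ⟧    I = not (⟦ Φ ⟧ I) Bool.∨ ⟦ Ψ ⟧ I
  ⟦ ∀[ p ] Φ ⟧ I = ⟦ Φ ⟧ (I [ p ≔ true ]) Bool.∧ ⟦ Φ ⟧ (I [ p ≔ false ])
  ⟦ ∃[ p ] Φ ⟧ I = ⟦ Φ ⟧ (I [ p ≔ true ]) Bool.∨ ⟦ Φ ⟧ (I [ p ≔ false ])

  ⟦embed⟧ : ∀ φ I → ⟦ embed φ ⟧ I ≡ eval I φ
  ⟦embed⟧ (atom p) I = refl
  ⟦embed⟧ ⊤        I = refl
  ⟦embed⟧ ⊥        I = refl
  ⟦embed⟧ (¬ φ)    I = cong not (⟦embed⟧ φ I)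
  ⟦embed⟧ (φ ∧ ψ)  I = cong₂ Bool._∧_ (⟦embed⟧ φ I) (⟦embed⟧ ψ I)
  ⟦embed⟧ (φ ∨ ψ)  I = cong₂ Bool._∨_ (⟦embed⟧ φ I) (⟦embed⟧ ψ I)
  ⟦embed⟧ (φ ⊃ ψ)  I = cong₂ (λ a b → not a Bool.∨ b) (⟦embed⟧ φ I) (⟦embed⟧ ψ I)

  ≔-cong : ∀ p b → I ≗ J → I [ p ≔ b ] ≗ J [ p ≔ b ]
  ≔-cong p b eq q with does (p ≟ q)
  ... | true  = refl
  ... | false = eq q

  ⟦⟧-cong : ∀ Φ → I ≗ J → ⟦ Φ ⟧ I ≡ ⟦ Φ ⟧ J
  ⟦⟧-cong (atom p)   eq = eq p
  ⟦⟧-cong ⊤          eq = refl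
  ⟦⟧-cong ⊥          eq = refl
  ⟦⟧-cong (¬ Φ)      eq = cong not (⟦⟧-cong Φ eq)
  ⟦⟧-cong (Φ ∧ Ψ)    eq = cong₂ Bool._∧_ (⟦⟧-cong Φ eq) (⟦⟧-cong Ψ eq)
  ⟦⟧-cong (Φ ∨ Ψ)    eq = cong₂ Bool._∨_ (⟦⟧-cong Φ eq) (⟦⟧-cong Ψ eq)
  ⟦⟧-cong (Φ ⊃ Ψ)    eq =
    cong₂ (λ a b → not a Bool.∨ b) (⟦⟧-cong Φ eq) (⟦⟧-cong Ψ eq)
  ⟦⟧-cong (∀[ p ] Φ) eq =
    cong₂ Bool._∧_ (⟦⟧-cong Φ (≔-cong p true eq)) (⟦⟧-cong Φ (≔-cong p false eq))
  ⟦⟧-cong (∃[ p ] Φ) eq =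
    cong₂ Bool._∨_ (⟦⟧-cong Φ (≔-cong p true eq)) (⟦⟧-cong Φ (≔-cong p false eq))

  ≔-self : ∀ p → I [ p ≔ I p ] ≗ I
  ≔-self p q with p ≟ q
  ... | yes refl = refl
  ... | no  _    = refl

  ≔-overwrite : ∀ p b c → (I [ p ≔ b ]) [ p ≔ c ] ≗ I [ p ≔ c ]
  ≔-overwrite p b c q with does (p ≟ q)
  ... | true  = refl
  ... | false = refl

  ≔-comm : ∀ {p q} b c → Neg.¬ (p ≡ q) →
           (I [ q ≔ c ]) [ p ≔ b ] ≗ (I [ p ≔ b ]) [ q ≔ c ]
  ≔-comm {p = p} {q} b c p≢q r with p ≟ r | q ≟ r
  ... | yes refl | yes refl = Neg.contradiction refl p≢q
  ... | yes _    | no  _    = refl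
  ... | no  _    | yes _    = refl
  ... | no  _    | no  _    = refl

  ⟦constant⟧ : ∀ b → ⟦ constant b ⟧ I ≡ b
  ⟦constant⟧ true  = refl
  ⟦constant⟧ false = refl

  -- The substitution lemma.
  ⟦/⟧      : ∀ Φ p b → ⟦ Φ [ p / b ] ⟧ I ≡ ⟦ Φ ⟧ (I [ p ≔ b ])
  -- The body of a quantifier over q, into which the substitution for p is
  -- pushed only when q differs from p.
  ⟦/⟧-body : ∀ Φ p b q c →
             ⟦ (if does (p ≟ q) then Φ else Φ [ p / b ]) ⟧ (I [ q ≔ c ])
             ≡ ⟦ Φ ⟧ ((I [ p ≔ b ]) [ q ≔ c ])

  ⟦/⟧ (atom q) p b with does (p ≟ q)
  ... | true  = ⟦constant⟧ b
  ... | false = refl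
  ⟦/⟧ ⊤          p b = refl
  ⟦/⟧ ⊥          p b = refl
  ⟦/⟧ (¬ Φ)      p b = cong not (⟦/⟧ Φ p b)
  ⟦/⟧ (Φ ∧ Ψ)    p b = cong₂ Bool._∧_ (⟦/⟧ Φ p b) (⟦/⟧ Ψ p b)
  ⟦/⟧ (Φ ∨ Ψ)    p b = cong₂ Bool._∨_ (⟦/⟧ Φ p b) (⟦/⟧ Ψ p b)
  ⟦/⟧ (Φ ⊃ Ψ)    p b = cong₂ (λ a b → not a Bool.∨ b) (⟦/⟧ Φ p b) (⟦/⟧ Ψ p b)
  ⟦/⟧ (∀[ q ] Φ) p b =
    cong₂ Bool._∧_ (⟦/⟧-body Φ p b q true) (⟦/⟧-body Φ p b q false)
  ⟦/⟧ (∃[ q ] Φ) p b =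
    cong₂ Bool._∨_ (⟦/⟧-body Φ p b q true) (⟦/⟧-body Φ p b q false)

  ⟦/⟧-body Φ p b q c with p ≟ q
  ... | yes refl = ⟦⟧-cong Φ (sym ∘ ≔-overwrite p b c)
  ... | no  p≢q  = trans (⟦/⟧ Φ p b) (⟦⟧-cong Φ (≔-comm b c p≢q))

  ⇓⇒⟦⟧ : ∀ {Φ b} → I ⊢ Φ ⇓ b → ⟦ Φ ⟧ I ≡ b
  ⇓⇒⟦⟧ atom    = refl
  ⇓⇒⟦⟧ ⊤       = refl
  ⇓⇒⟦⟧ ⊥       = refl
  ⇓⇒⟦⟧ (¬ d)   = cong not (⇓⇒⟦⟧ d)
  ⇓⇒⟦⟧ (d ∧ e) = cong₂ Bool._∧_ (⇓⇒⟦⟧ d) (⇓⇒⟦⟧ e)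
  ⇓⇒⟦⟧ (d ∨ e) = cong₂ Bool._∨_ (⇓⇒⟦⟧ d) (⇓⇒⟦⟧ e)
  ⇓⇒⟦⟧ (d ⊃ e) = cong₂ (λ a b → not a Bool.∨ b) (⇓⇒⟦⟧ d) (⇓⇒⟦⟧ e)
  ⇓⇒⟦⟧ (∀[] {p} {Φ} d e) = cong₂ Bool._∧_
    (trans (sym (⟦/⟧ Φ p true)) (⇓⇒⟦⟧ d)) (trans (sym (⟦/⟧ Φ p false)) (⇓⇒⟦⟧ e))
  ⇓⇒⟦⟧ (∃[] {p} {Φ} d e) = cong₂ Bool._∨_
    (trans (sym (⟦/⟧ Φ p true)) (⇓⇒⟦⟧ d)) (trans (sym (⟦/⟧ Φ p false)) (⇓⇒⟦⟧ e))

  -- The syntax tree of a QBF without its labels.  Substitution of truth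
  -- constants preserves it, which makes it a measure for recursion through
  -- substitution instances.
  data Shape : Set where
    leaf   : Shape
    unary  : Shape → Shape
    binary : Shape → Shape → Shape

  shape : QBF C → Shape
  shape (atom p)   = leaf
  shape ⊤          = leaf
  shape ⊥          = leaf
  shape (¬ Φ)      = unary (shape Φ)
  shape (Φ ∧ Ψ)    = binary (shape Φ) (shape Ψ)
  shape (Φ ∨ Ψ)    = binary (shape Φ) (shape Ψ)
  shape (Φ ⊃ Ψ)    = binary (shape Φ) (shape Ψ)
  shape (∀[ p ] Φ) = unary (shape Φ)
  shape (∃[ p ] Φ) = unary (shape Φ)

  shape-/      : ∀ Φ p b → shape (Φ [ p / b ]) ≡ shape Φ
  shape-/-body : ∀ Φ p b q →
                 shape (if does (p ≟ q) then Φ else Φ [ p / b ]) ≡ shape Φ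

  shape-/ (atom q) p b with does (p ≟ q) | b
  ... | true  | true  = refl
  ... | true  | false = refl
  ... | false | _     = refl
  shape-/ ⊤          p b = refl
  shape-/ ⊥          p b = refl
  shape-/ (¬ Φ)      p b = cong unary (shape-/ Φ p b)
  shape-/ (Φ ∧ Ψ)    p b = cong₂ binary (shape-/ Φ p b) (shape-/ Ψ p b)
  shape-/ (Φ ∨ Ψ)    p b = cong₂ binary (shape-/ Φ p b) (shape-/ Ψ p b)
  shape-/ (Φ ⊃ Ψ)    p b = cong₂ binary (shape-/ Φ p b) (shape-/ Ψ p b)
  shape-/ (∀[ q ] Φ) p b = cong unary (shape-/-body Φ p b q)
  shape-/ (∃[ q ] Φ) p b = cong unary (shape-/-body Φ p b q)

  shape-/-body Φ p b q with does (p ≟ q)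
  ... | true  = refl
  ... | false = shape-/ Φ p b

  ⇓-total : ∀ s Φ → shape Φ ≡ s → ∃ λ b → I ⊢ Φ ⇓ b
  ⇓-total s (atom p) _ = _ , atom
  ⇓-total s ⊤        _ = _ , ⊤
  ⇓-total s ⊥        _ = _ , ⊥
  ⇓-total (unary s) (¬ Φ) refl = _ , ¬ proj₂ (⇓-total s Φ refl)
  ⇓-total (binary s t) (Φ ∧ Ψ) refl =
    _ , proj₂ (⇓-total s Φ refl) ∧ proj₂ (⇓-total t Ψ refl)
  ⇓-total (binary s t) (Φ ∨ Ψ) refl =
    _ , proj₂ (⇓-total s Φ refl) ∨ proj₂ (⇓-total t Ψ refl)
  ⇓-total (binary s t) (Φ ⊃ Ψ) refl =
    _ , proj₂ (⇓-total s Φ refl) ⊃ proj₂ (⇓-total t Ψ refl)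
  ⇓-total (unary s) (∀[ p ] Φ) refl =
    _ , ∀[] (proj₂ (⇓-total s (Φ [ p / true ])  (shape-/ Φ p true)))
            (proj₂ (⇓-total s (Φ [ p / false ]) (shape-/ Φ p false)))
  ⇓-total (unary s) (∃[ p ] Φ) refl =
    _ , ∃[] (proj₂ (⇓-total s (Φ [ p / true ])  (shape-/ Φ p true)))
            (proj₂ (⇓-total s (Φ [ p / false ]) (shape-/ Φ p false)))

  ⇓⇔⟦⟧ : ∀ {Φ b} → (I ⊢ Φ ⇓ b) ⇔ (⟦ Φ ⟧ I ≡ b)
  ⇓⇔⟦⟧ {I} {Φ} = mk⇔ ⇓⇒⟦⟧ λ eq →
    let _ , d = ⇓-total (shape Φ) Φ refl
    in subst (I ⊢ Φ ⇓_) (trans (sym (⇓⇒⟦⟧ d)) eq) d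

  -- Truth under all interpretations absorbs a block of universal quantifiers.
  ∀⋆-true : ∀ P Φ → (∀ I → ⟦ ∀⋆[ P ] Φ ⟧ I ≡ true) ⇔ (∀ I → ⟦ Φ ⟧ I ≡ true)
  ∀⋆-true []      Φ = ⇔-refl
  ∀⋆-true (p ∷ P) Φ = ⇔-trans
    (mk⇔ (λ h I → trans (sym (⟦⟧-cong (∀⋆[ P ] Φ) (≔-self p))) (instantiate I (I p) h))
         (λ h I → from (∧-true _ _) (h _ , h _)))
    (∀⋆-true P Φ)
    where
    instantiate : ∀ I b → (∀ I → ⟦ ∀[ p ] ∀⋆[ P ] Φ ⟧ I ≡ true) →
                  ⟦ ∀⋆[ P ] Φ ⟧ (I [ p ≔ b ]) ≡ true
    instantiate I true  h = proj₁ (to (∧-true _ _) (h I))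
    instantiate I false h = proj₂ (to (∧-true _ _) (h I))

  ⊨∀⋆ : ∀ P Φ → ⊨ (∀⋆[ P ] Φ) ⇔ (∀ I → ⟦ Φ ⟧ I ≡ true)
  ⊨∀⋆ P Φ = ⇔-trans
    (mk⇔ (λ h I → to ⇓⇔⟦⟧ (h I)) (λ h I → from ⇓⇔⟦⟧ (h I))) (∀⋆-true P Φ)

  ∃⋆-true : ∀ P Φ → ⟦ ∃⋆[ P ] Φ ⟧ I ≡ true
                  ⇔ (∃ λ J → (∀ q → q ∉ P → J q ≡ I q) × ⟦ Φ ⟧ J ≡ true)
  ∃⋆-true [] Φ = mk⇔ (λ h → _ , (λ _ _ → refl) , h)
    (λ (J , eq , h) → trans (⟦⟧-cong Φ (λ q → sym (eq q λ ()))) h)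
  ∃⋆-true {I} (p ∷ P) Φ = ⇔-trans (∨-true _ _) (mk⇔
    [ extend true , extend false ]′
    (λ (J , eq , h) → select (J p)
      (from (∃⋆-true P Φ) (J , (λ q q∉P → agree J eq q q∉P) , h))))
    where
    extend : ∀ b → ⟦ ∃⋆[ P ] Φ ⟧ (I [ p ≔ b ]) ≡ true →
             ∃ λ J → (∀ q → q ∉ p ∷ P → J q ≡ I q) × ⟦ Φ ⟧ J ≡ true
    extend b h with J , eq , h′ ← to (∃⋆-true P Φ) h =
      J , (λ q q∉ → trans (eq q (q∉ ∘ there)) (off q (q∉ ∘ here))) , h′
      where
      off : ∀ q → Neg.¬ (q ≡ p) → (I [ p ≔ b ]) q ≡ I q
      off q q≢p with p ≟ q
      ... | yes refl = Neg.contradiction refl q≢p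
      ... | no  _    = refl
    agree : ∀ J → (∀ q → q ∉ p ∷ P → J q ≡ I q) →
            ∀ q → q ∉ P → J q ≡ (I [ p ≔ J p ]) q
    agree J eq q q∉P with p ≟ q
    ... | yes refl = refl
    ... | no  p≢q  = eq q λ { (here refl) → p≢q refl ; (there q∈P) → q∉P q∈P }
    select : ∀ b → ⟦ ∃⋆[ P ] Φ ⟧ (I [ p ≔ b ]) ≡ true →
             ⟦ ∃⋆[ P ] Φ ⟧ (I [ p ≔ true ]) ≡ true
             ⊎ ⟦ ∃⋆[ P ] Φ ⟧ (I [ p ≔ false ]) ≡ true
    select true  = inj₁
    select false = inj₂

-- Interpretations and reducts

module Reducts {A : Set} where

  private
    variable
      V W         : List A
      X X′ Y Y′ Z : Interp A
      Π Δ         : Program A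

  -- Interpretations compared on a finite alphabet

  infix 4 _≈[_]_ _≤[_]_ _<[_]_

  -- Equality, inclusion and strict inclusion of X and Y on the atoms of V.
  _≈[_]_ _≤[_]_ _<[_]_ : Interp A → List A → Interp A → Set
  X ≈[ V ] Y = ∀ v → v ∈ V → X v ≡ Y v
  X ≤[ V ] Y = ∀ v → v ∈ V → X v ≡ true → Y v ≡ true
  X <[ V ] Y = X ≤[ V ] Y × Neg.¬ (Y ≤[ V ] X)

  ≈-sym : X ≈[ V ] Y → Y ≈[ V ] X
  ≈-sym x v v∈V = sym (x v v∈V)

  ≈-restrict : V ⊆ˡ W → X ≈[ W ] Y → X ≈[ V ] Y
  ≈-restrict V⊆W x v v∈V = x v (V⊆W v∈V)

  ≈⇒≤ : X ≈[ V ] Y → X ≤[ V ] Y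
  ≈⇒≤ x v v∈V = trans (sym (x v v∈V))

  ≤-trans : X ≤[ V ] Y → Y ≤[ V ] Z → X ≤[ V ] Z
  ≤-trans p q v v∈V = q v v∈V ∘ p v v∈V

  ≤-antisym : X ≤[ V ] Y → Y ≤[ V ] X → X ≈[ V ] Y
  ≤-antisym p q v v∈V = ⇔→≡ (mk⇔ (p v v∈V) (q v v∈V))

  ⊆⇒≤ : X ⊆ Y → X ≤[ V ] Y
  ⊆⇒≤ p v _ = p v

  ≤-resp : X ≈[ V ] X′ → Y ≈[ V ] Y′ → X ≤[ V ] Y → X′ ≤[ V ] Y′
  ≤-resp {V = V} x y p =
    ≤-trans {V = V} (≈⇒≤ (≈-sym x)) (≤-trans {V = V} p (≈⇒≤ y))

  <-resp : X ≈[ V ] X′ → Y ≈[ V ] Y′ → X <[ V ] Y → X′ <[ V ] Y′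
  <-resp x y (p , ¬q) = ≤-resp x y p , ¬q ∘ ≤-resp (≈-sym y) (≈-sym x)

  ≤-dec : ∀ V (X Y : Interp A) → Dec (X ≤[ V ] Y)
  ≤-dec V X Y = Dec-map
    (mk⇔ (λ ps v v∈V → All.lookup ps v∈V) (λ p → All.tabulate λ {v} → p v))
    (all? (λ v → (X v ≟ᵇ true) →-dec (Y v ≟ᵇ true)) V)

  eval-≤ : ∀ V (f g : A → C) (I : Interp C) →
           eval I (V ⟨ f ≤ g ⟩) ≡ true ⇔ (I ∘ f) ≤[ V ] (I ∘ g)
  eval-≤ V f g I = ⇔-trans (⋀-true I _ V)
    (mk⇔ (λ p v v∈V → to (⊃-true _ _) (p v v∈V))
         (λ p v v∈V → from (⊃-true _ _) (p v v∈V)))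

  eval-< : ∀ V (f g : A → C) (I : Interp C) →
           eval I (V ⟨ f < g ⟩) ≡ true ⇔ (I ∘ f) <[ V ] (I ∘ g)
  eval-< V f g I = ⇔-trans (∧-true _ _)
    (eval-≤ V f g I ×-⇔ ⇔-trans (not-true _) (¬-cong-⇔ (eval-≤ V g f I)))

  -- Satisfaction of reducts

  eval-cong : ∀ (φ : Formula A) → X ≈[ atoms φ ] Y → eval X φ ≡ eval Y φ
  eval-cong (atom p) x = x p (here refl)
  eval-cong ⊤        x = refl
  eval-cong ⊥        x = refl
  eval-cong (¬ φ)    x = cong not (eval-cong φ x)
  eval-cong (φ ∧ ψ)  x = cong₂ Bool._∧_
    (eval-cong φ (≈-restrict ∈-++⁺ˡ x)) (eval-cong ψ (≈-restrict (∈-++⁺ʳ (atoms φ)) x))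
  eval-cong (φ ∨ ψ)  x = cong₂ Bool._∨_
    (eval-cong φ (≈-restrict ∈-++⁺ˡ x)) (eval-cong ψ (≈-restrict (∈-++⁺ʳ (atoms φ)) x))
  eval-cong (φ ⊃ ψ)  x = cong₂ (λ a b → not a Bool.∨ b)
    (eval-cong φ (≈-restrict ∈-++⁺ˡ x)) (eval-cong ψ (≈-restrict (∈-++⁺ʳ (atoms φ)) x))

  eval-rename : ∀ (f : A → C) φ (I : Interp C) →
                eval I (rename f φ) ≡ eval (I ∘ f) φ
  eval-rename f (atom p) I = refl
  eval-rename f ⊤        I = refl
  eval-rename f ⊥        I = refl
  eval-rename f (¬ φ)    I = cong not (eval-rename f φ I)
  eval-rename f (φ ∧ ψ)  I = cong₂ Bool._∧_ (eval-rename f φ I) (eval-rename f ψ I)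
  eval-rename f (φ ∨ ψ)  I = cong₂ Bool._∨_ (eval-rename f φ I) (eval-rename f ψ I)
  eval-rename f (φ ⊃ ψ)  I =
    cong₂ (λ a b → not a Bool.∨ b) (eval-rename f φ I) (eval-rename f ψ I)

  eval-reduct-¬ : ∀ (X Y : Interp A) ψ →
                  eval X ⌜ reductᵉ Y (¬ ψ) ⌝ ≡ not (eval Y ⌜ ψ ⌝)
  eval-reduct-¬ X Y ψ with eval Y ⌜ ψ ⌝
  ... | true  = refl
  ... | false = refl

  eval-reduct-cong : ∀ (φ : Expr A) → X ≈[ atoms ⌜ φ ⌝ ] X′ → Y ≈[ atoms ⌜ φ ⌝ ] Y′ →
                     eval X ⌜ reductᵉ Y φ ⌝ ≡ eval X′ ⌜ reductᵉ Y′ φ ⌝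
  eval-reduct-cong (atom p) x y = x p (here refl)
  eval-reduct-cong ⊤        x y = refl
  eval-reduct-cong ⊥        x y = refl
  eval-reduct-cong {X = X} {X′} {Y} {Y′} (¬ ψ) x y = begin
    eval X ⌜ reductᵉ Y (¬ ψ) ⌝    ≡⟨ eval-reduct-¬ X Y ψ ⟩
    not (eval Y ⌜ ψ ⌝)            ≡⟨ cong not (eval-cong ⌜ ψ ⌝ y) ⟩
    not (eval Y′ ⌜ ψ ⌝)           ≡⟨ eval-reduct-¬ X′ Y′ ψ ⟨
    eval X′ ⌜ reductᵉ Y′ (¬ ψ) ⌝  ∎
    where open ≡-Reasoning
  eval-reduct-cong (φ ∧ ψ) x y = cong₂ Bool._∧_
    (eval-reduct-cong φ (≈-restrict ∈-++⁺ˡ x) (≈-restrict ∈-++⁺ˡ y))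
    (eval-reduct-cong ψ (≈-restrict (∈-++⁺ʳ (atoms ⌜ φ ⌝)) x)
                        (≈-restrict (∈-++⁺ʳ (atoms ⌜ φ ⌝)) y))
  eval-reduct-cong (φ ∨ ψ) x y = cong₂ Bool._∨_
    (eval-reduct-cong φ (≈-restrict ∈-++⁺ˡ x) (≈-restrict ∈-++⁺ˡ y))
    (eval-reduct-cong ψ (≈-restrict (∈-++⁺ʳ (atoms ⌜ φ ⌝)) x)
                        (≈-restrict (∈-++⁺ʳ (atoms ⌜ φ ⌝)) y))

  eval-reduct-self : ∀ (Y : Interp A) φ → eval Y ⌜ reductᵉ Y φ ⌝ ≡ eval Y ⌜ φ ⌝
  eval-reduct-self Y (atom p) = refl
  eval-reduct-self Y ⊤        = refl
  eval-reduct-self Y ⊥        = refl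
  eval-reduct-self Y (¬ ψ)    = eval-reduct-¬ Y Y ψ
  eval-reduct-self Y (φ ∧ ψ)  = cong₂ Bool._∧_ (eval-reduct-self Y φ) (eval-reduct-self Y ψ)
  eval-reduct-self Y (φ ∨ ψ)  = cong₂ Bool._∨_ (eval-reduct-self Y φ) (eval-reduct-self Y ψ)

  infix 4 _⊩[_]_

  -- X ⊩[ Y ] Π: X is a model of the reduct of Π with respect to Y.
  _⊩[_]_ : Interp A → Interp A → Program A → Set
  X ⊩[ Y ] Π = ∀ r → r ∈ Π →
    eval X ⌜ reductᵉ Y (B r) ⌝ ≡ true → eval X ⌜ reductᵉ Y (H r) ⌝ ≡ true

  Model⇔⊩ : ∀ Π (X Y : Interp A) → Model (reduct Y Π) X ⇔ X ⊩[ Y ] Π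
  Model⇔⊩ Π X Y = ⇔-trans (⋀-true X _ (reduct Y Π)) (mk⇔
    (λ h r r∈Π → to (⊃-true _ _) (h _ (∈-map⁺ _ r∈Π)))
    (λ h _ s∈ → case ∈-map⁻ _ s∈ of λ
      { (r , r∈Π , refl) → from (⊃-true _ _) (h r r∈Π) }))

  ⊩-dec : ∀ Π (X Y : Interp A) → Dec (X ⊩[ Y ] Π)
  ⊩-dec Π X Y = Dec-map (Model⇔⊩ Π X Y) (_ ≟ᵇ true)

  hat⇔⊩ : ∀ Π (Y : Interp A) → eval Y (hat Π) ≡ true ⇔ Y ⊩[ Y ] Π
  hat⇔⊩ Π Y = ⇔-trans (⋀-true Y _ Π) (mk⇔
    (λ h r r∈Π b → trans (eval-reduct-self Y (H r))
      (to (⊃-true _ _) (h r r∈Π) (trans (sym (eval-reduct-self Y (B r))) b)))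
    (λ h r r∈Π → from (⊃-true _ _) λ b → trans (sym (eval-reduct-self Y (H r)))
      (h r r∈Π (trans (eval-reduct-self Y (B r)) b))))

  -- Only the atoms of Π matter.
  ⊩-resp : var Π ⊆ˡ V → X ≈[ V ] X′ → Y ≈[ V ] Y′ → X ⊩[ Y ] Π → X′ ⊩[ Y′ ] Π
  ⊩-resp {Π = Π} {V} {X} {X′} {Y} {Y′} Π⊆V x y h r r∈Π b =
    trans (sym (agree (H r) (inV ∘ ∈-++⁺ˡ)))
      (h r r∈Π (trans (agree (B r) (inV ∘ ∈-++⁺ʳ (atoms ⌜ H r ⌝))) b))
    where
    inV : atoms ⌜ H r ⌝ ++ atoms ⌜ B r ⌝ ⊆ˡ V
    inV = Π⊆V ∘ ∈-concatMap⁺ _ ∘ lose r∈Π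
    agree : ∀ φ → atoms ⌜ φ ⌝ ⊆ˡ V →
            eval X ⌜ reductᵉ Y φ ⌝ ≡ eval X′ ⌜ reductᵉ Y′ φ ⌝
    agree φ φ⊆V = eval-reduct-cong φ (≈-restrict φ⊆V x) (≈-restrict φ⊆V y)

  ⊩-++ : ∀ Π → X ⊩[ Y ] Π ++ Δ ⇔ (X ⊩[ Y ] Π × X ⊩[ Y ] Δ)
  ⊩-++ Π = mk⇔
    (λ h → (λ r → h r ∘ ∈-++⁺ˡ) , (λ r → h r ∘ ∈-++⁺ʳ Π))
    (λ (h , k) r → [ h r , k r ]′ ∘ ∈-++⁻ Π)

  -- Y is a stable model of Π ∪ Δ.
  StableWith : Program A → Program A → Interp A → Set
  StableWith Π Δ Y = Y ⊩[ Y ] Π × Y ⊩[ Y ] Δ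
                   × (∀ J → J ⊩[ Y ] Π → J ⊩[ Y ] Δ → J ⊆ Y → Y ⊆ J)

  Stable-++ : ∀ Π Δ (Y : Interp A) → Stable (Π ++ Δ) Y ⇔ StableWith Π Δ Y
  Stable-++ Π Δ Y = mk⇔
    (λ (m , least) → let m₁ , m₂ = to (reducts Y) m in
      m₁ , m₂ , λ J j₁ j₂ → least J (from (reducts J) (j₁ , j₂)))
    (λ (m₁ , m₂ , least) → from (reducts Y) (m₁ , m₂) ,
      λ J m → let j₁ , j₂ = to (reducts J) m in least J j₁ j₂)
    where
    reducts : ∀ X → Model (reduct Y (Π ++ Δ)) X ⇔ (X ⊩[ Y ] Π × X ⊩[ Y ] Δ)
    reducts X = ⇔-trans (Model⇔⊩ (Π ++ Δ) X Y) (⊩-++ Π)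

  -- SE pairs: the SE-models (X , Y) of Π, without the requirement that X be
  -- contained in Y.
  SE : Program A → Interp A → Interp A → Set
  SE Π X Y = X ⊩[ Y ] Π × Y ⊩[ Y ] Π

  SE-resp : var Π ⊆ˡ V → X ≈[ V ] X′ → Y ≈[ V ] Y′ → SE Π X Y → SE Π X′ Y′
  SE-resp Π⊆V x y (m , n) = ⊩-resp Π⊆V x y m , ⊩-resp Π⊆V y y n

  -- Truth of the translation

  eval-τ : ∀ (φ : Expr A) I →
           eval I (τ ⌜ φ ⌝) ≡ eval (I ∘ _°) ⌜ reductᵉ (I ∘ _′) φ ⌝
  eval-τ (atom p) I = refl
  eval-τ ⊤        I = refl
  eval-τ ⊥        I = refl
  eval-τ (¬ ψ)    I = trans (cong not (eval-rename _′ ⌜ ψ ⌝ I))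
                            (sym (eval-reduct-¬ (I ∘ _°) (I ∘ _′) ψ))
  eval-τ (φ ∧ ψ)  I = cong₂ Bool._∧_ (eval-τ φ I) (eval-τ ψ I)
  eval-τ (φ ∨ ψ)  I = cong₂ Bool._∨_ (eval-τ φ I) (eval-τ ψ I)

  τ-rule : ∀ (r : Rule A) I → eval I (τ ⌜ B r ⌝ ⊃ τ ⌜ H r ⌝) ≡ true ⇔
           (eval (I ∘ _°) ⌜ reductᵉ (I ∘ _′) (B r) ⌝ ≡ true →
            eval (I ∘ _°) ⌜ reductᵉ (I ∘ _′) (H r) ⌝ ≡ true)
  τ-rule r I rewrite eval-τ (B r) I | eval-τ (H r) I = ⊃-true _ _

  τ-rules : ∀ Π (I : Interp (Primed A)) →
            eval I (⋀ (map (λ r → τ ⌜ B r ⌝ ⊃ τ ⌜ H r ⌝) Π)) ≡ true ⇔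
            (I ∘ _°) ⊩[ I ∘ _′ ] Π
  τ-rules Π I = ⇔-trans (⋀-true I _ Π)
    (mk⇔ (λ h r r∈Π → to (τ-rule r I) (h r r∈Π))
         (λ h r r∈Π → from (τ-rule r I) (h r r∈Π)))

  hat′-true : ∀ Π (I : Interp (Primed A)) →
              eval I (rename _′ (hat Π)) ≡ true ⇔ (I ∘ _′) ⊩[ I ∘ _′ ] Π
  hat′-true Π I rewrite eval-rename _′ (hat Π) I = hat⇔⊩ Π (I ∘ _′)

  -- The translation of an implication is a conjunction, whose first conjuncts
  -- and second conjuncts are collected separately.
  τ-hat-split : ∀ Π (I : Interp (Primed A)) → eval I (τ (hat Π)) ≡ true ⇔
                (eval I (⋀ (map (λ r → τ ⌜ B r ⌝ ⊃ τ ⌜ H r ⌝) Π)) ≡ true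
                 × eval I (rename _′ (hat Π)) ≡ true)
  τ-hat-split []      I = mk⇔ (_, refl) proj₁
  τ-hat-split (r ∷ Π) I =
    ⇔-trans (∧-true _ _) (⇔-trans (∧-true _ _ ×-⇔ τ-hat-split Π I) (⇔-trans
      (mk⇔ (λ ((a , b) , (c , d)) → (a , c) , (b , d))
           (λ ((a , c) , (b , d)) → (a , b) , (c , d)))
      (⇔-sym (∧-true _ _) ×-⇔ ⇔-sym (∧-true _ _))))

  τ-hat : ∀ Π (I : Interp (Primed A)) →
          eval I (τ (hat Π)) ≡ true ⇔ SE Π (I ∘ _°) (I ∘ _′)
  τ-hat Π I = ⇔-trans (τ-hat-split Π I) (τ-rules Π I ×-⇔ hat′-true Π I)

  -- Interpolants, stability on an alphabet, and extensions by simple rules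

  -- Some Z between X and Y on V, strictly below Y, forms an SE pair of Π with Y.
  Interpolant : List A → Program A → Interp A → Interp A → Set
  Interpolant V Π X Y = ∃ λ Z → X ≤[ V ] Z × Z <[ V ] Y × SE Π Z Y

  -- Stability with minimality judged on V only.
  StableOn : List A → Program A → Interp A → Set
  StableOn V Π Y = Y ⊩[ Y ] Π × (∀ X → X <[ V ] Y → Neg.¬ (X ⊩[ Y ] Π))

  facts : List A → Program A
  facts = map (λ p → atom p ← ⊤)

  ⊩-facts : ∀ L → X ⊩[ Y ] facts L ⇔ (∀ p → p ∈ L → X p ≡ true)
  ⊩-facts L = mk⇔
    (λ h p p∈L → h _ (∈-map⁺ _ p∈L) refl)
    (λ h _ r∈ _ → case ∈-map⁻ _ r∈ of λ { (p , p∈L , refl) → h p p∈L })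

  facts-areFacts : ∀ (L : List A) → All IsFact (facts L)
  facts-areFacts L = All.tabulate λ r∈ →
    case ∈-map⁻ _ r∈ of λ { (p , _ , refl) → p , refl }

  -- The rules p ← q for p in L and q in M.
  links : List A → List A → Program A
  links = cartesianProductWith (λ p q → atom p ← atom q)

  ⊩-links : ∀ L M → X ⊩[ Y ] links L M ⇔
            (∀ p q → p ∈ L → q ∈ M → X q ≡ true → X p ≡ true)
  ⊩-links L M = mk⇔
    (λ h p q p∈L q∈M → h _ (∈-cartesianProductWith⁺ _ p∈L q∈M))
    (λ h _ r∈ → case ∈-cartesianProductWith⁻ _ L M r∈ of λ
      { (p , q , p∈L , q∈M , refl) → h p q p∈L q∈M })

  -- The atoms of V that belong, respectively do not belong, to X.
  members nonmembers : List A → Interp A → List A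
  members    V X = filter (λ v → X v ≟ᵇ true) V
  nonmembers V X = filter (λ v → X v ≟ᵇ false) V

  ⊩-facts-members : ∀ V (Z : Interp A) → X ⊩[ Y ] facts (members V Z) ⇔ Z ≤[ V ] X
  ⊩-facts-members V Z = ⇔-trans (⊩-facts _) (mk⇔
    (λ h v v∈V Zv → h v (∈-filter⁺ _ v∈V Zv))
    (λ h v v∈ → let v∈V , Zv = ∈-filter⁻ _ v∈ in h v v∈V Zv))

  -- The links make all of Z true as soon as an atom of V outside Z′ is true.
  ⊩-links-members : ∀ V (Z Z′ : Interp A) →
    X ⊩[ Y ] links (members V Z) (nonmembers V Z′) ⇔ (X ≤[ V ] Z′ ⊎ Z ≤[ V ] X)
  ⊩-links-members {X = X} V Z Z′ = ⇔-trans (⊩-links _ _) (mk⇔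
    (λ h → case ≤-dec V Z X of λ
      { (yes p) → inj₂ p
      ; (no ¬p) → inj₁ λ q q∈V Xq → ¬-not {y = false} λ Z′q → ¬p λ p p∈V Zp →
          h p q (∈-filter⁺ _ p∈V Zp) (∈-filter⁺ _ q∈V Z′q) Xq })
    (λ { (inj₁ X≤Z′) p q _ q∈ Xq → let q∈V , Z′q = ∈-filter⁻ _ q∈ in
           Neg.contradiction (trans (sym (X≤Z′ q q∈V Xq)) Z′q) λ ()
       ; (inj₂ Z≤X) p q p∈ _ _ → let p∈V , Zp = ∈-filter⁻ _ p∈ in Z≤X p p∈V Zp }))

open Reducts

-- Restriction to a finite alphabet

module Restriction {A : Set} (_≟_ : DecidableEquality A) where
  open DecMembership _≟_ using (_∈?_)

  private
    variable
      V         : List A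
      X Y Y′    : Interp A
      Π Π₁ Π₂ Δ : Program A

  -- X on V and Y elsewhere.
  splice : List A → Interp A → Interp A → Interp A
  splice V X Y p = if does (p ∈? V) then X p else Y p

  splice-≈ : ∀ V (X Y : Interp A) → splice V X Y ≈[ V ] X
  splice-≈ V X Y v v∈V rewrite dec-true (v ∈? V) v∈V = refl

  splice-∉ : ∀ {V p} (X Y : Interp A) → p ∉ V → splice V X Y p ≡ Y p
  splice-∉ {V} {p} X Y p∉V rewrite dec-false (p ∈? V) p∉V = refl

  infix 21 _↾_

  -- The intersection of X with V.
  _↾_ : Interp A → List A → Interp A
  X ↾ V = splice V X (const false)

  ↾-≈ : ∀ V X → X ↾ V ≈[ V ] X
  ↾-≈ V X = splice-≈ V X _

  -- X ↾ V is the least interpretation that contains X on V.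
  ↾-least : X ≤[ V ] Y → X ↾ V ⊆ Y
  ↾-least {V = V} X≤Y p Xp with p ∈? V
  ... | yes p∈V = X≤Y p p∈V Xp

  ↾-mono : X ≤[ V ] Y → X ↾ V ⊆ Y ↾ V
  ↾-mono {X} {V} {Y} X≤Y = ↾-least (≤-resp (λ _ _ → refl) (≈-sym (↾-≈ V Y)) X≤Y)

  Stable⇔StableOn : var Π ⊆ˡ V → Stable Π Y ⇔ (Y ⊆ Y ↾ V × StableOn V Π Y)
  Stable⇔StableOn {Π = Π} {V} {Y} Π⊆V = mk⇔
    (λ (m , least) →
       let m′ = to (Model⇔⊩ Π Y Y) m
           least′ = λ J → least J ∘ from (Model⇔⊩ Π J Y)
       in least′ (Y ↾ V) (⊩-resp Π⊆V (≈-sym (↾-≈ V Y)) (λ _ _ → refl) m′)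
                 (↾-least {V = V} λ _ _ → id)
          , m′
          , λ X (X≤Y , Y≰X) x → Y≰X (≤-resp (λ _ _ → refl) (↾-≈ V X) (⊆⇒≤
              (least′ (X ↾ V) (⊩-resp Π⊆V (≈-sym (↾-≈ V X)) (λ _ _ → refl) x)
                      (↾-least X≤Y)))))
    (λ (Y⊆V , m , minimal) → from (Model⇔⊩ Π Y Y) m ,
       λ J j J⊆Y p Yp → case ≤-dec V Y J of λ
         { (yes Y≤J) → ↾-least Y≤J p (Y⊆V p Yp)
         ; (no Y≰J)  → Neg.contradiction (to (Model⇔⊩ Π J Y) j)
                         (minimal J (⊆⇒≤ J⊆Y , Y≰J)) })

  StableOn-resp : var Π ⊆ˡ V → Y ≈[ V ] Y′ → StableOn V Π Y → StableOn V Π Y′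
  StableOn-resp Π⊆V y (m , minimal) = ⊩-resp Π⊆V y y m , λ X X<Y′ x →
    minimal X (<-resp (λ _ _ → refl) (≈-sym y) X<Y′)
            (⊩-resp Π⊆V (λ _ _ → refl) (≈-sym y) x)

  -- Ordinary equivalence

  -- The interpretation Y may contain atoms outside V, so stability is compared
  -- at Y ↾ V.
  ≡ₒ-transfer : ∀ Π₁ Π₂ → var Π₁ ⊆ˡ V → var Π₂ ⊆ˡ V → Π₁ ≡ₒ Π₂ →
                StableOn V Π₁ Y → StableOn V Π₂ Y
  ≡ₒ-transfer {V = V} {Y = Y} Π₁ Π₂ Π₁⊆V Π₂⊆V eq s = StableOn-resp Π₂⊆V (↾-≈ V Y)
    (proj₂ (to (Stable⇔StableOn Π₂⊆V) (to (eq (Y ↾ V))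
      (from (Stable⇔StableOn Π₁⊆V)
        ( ↾-mono {X = Y} (≈⇒≤ (≈-sym (↾-≈ V Y))) , StableOn-resp Π₁⊆V (≈-sym (↾-≈ V Y)) s)))))

  ≡ₒ-sym : ∀ (Π₁ Π₂ : Program A) → Π₁ ≡ₒ Π₂ → Π₂ ≡ₒ Π₁
  ≡ₒ-sym Π₁ Π₂ eq I = ⇔-sym (eq I)

  ≡ₒ⇔ : var Π₁ ⊆ˡ V → var Π₂ ⊆ˡ V →
        Π₁ ≡ₒ Π₂ ⇔ (∀ Y → StableOn V Π₁ Y ⇔ StableOn V Π₂ Y)
  ≡ₒ⇔ {Π₁ = Π₁} {Π₂ = Π₂} Π₁⊆V Π₂⊆V = mk⇔
    (λ eq Y → mk⇔ (≡ₒ-transfer Π₁ Π₂ Π₁⊆V Π₂⊆V eq)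
                  (≡ₒ-transfer Π₂ Π₁ Π₂⊆V Π₁⊆V (≡ₒ-sym Π₁ Π₂ eq)))
    (λ eq Y → ⇔-trans (Stable⇔StableOn Π₁⊆V)
                (⇔-trans (⇔-refl ×-⇔ eq Y) (⇔-sym (Stable⇔StableOn Π₂⊆V))))

  -- Uniform equivalence

  ≡ᵤ-sym : ∀ (Π₁ Π₂ : Program A) → Π₁ ≡ᵤ Π₂ → Π₂ ≡ᵤ Π₁
  ≡ᵤ-sym Π₁ Π₂ eq Δ Δ-facts = ≡ₒ-sym (Π₁ ++ Δ) (Π₂ ++ Δ) (eq Δ Δ-facts)

  ≡ₒ-++ : ∀ Π₁ Π₂ → Π₁ ++ Δ ≡ₒ Π₂ ++ Δ → StableWith Π₁ Δ Y → StableWith Π₂ Δ Y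
  ≡ₒ-++ {Y = Y} Π₁ Π₂ eq = to (Stable-++ _ _ Y) ∘ to (eq Y) ∘ from (Stable-++ _ _ Y)

  -- The part on V of a model Y of Π₁ is stable for Π₁ once its atoms are added
  -- as facts.
  ≡ᵤ⇒model : ∀ Π₁ Π₂ → var Π₁ ⊆ˡ V → var Π₂ ⊆ˡ V → Π₁ ≡ᵤ Π₂ →
             Y ⊩[ Y ] Π₁ → Y ⊩[ Y ] Π₂
  ≡ᵤ⇒model {V = V} {Y = Y} Π₁ Π₂ Π₁⊆V Π₂⊆V eq m =
    ⊩-resp Π₂⊆V (↾-≈ V Y) (↾-≈ V Y) (proj₁ (≡ₒ-++ {Y = Y ↾ V} Π₁ Π₂
      (eq _ (facts-areFacts (members V Y)))
      ( ⊩-resp Π₁⊆V (≈-sym (↾-≈ V Y)) (≈-sym (↾-≈ V Y)) m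
      , from (⊩-facts-members V Y) (≈⇒≤ (≈-sym (↾-≈ V Y)))
      , λ J _ j _ → ↾-least (to (⊩-facts-members V Y) j))))

  -- If X <[ V ] Y is an SE pair of Π₁, then Y ↾ V is not stable for Π₁ extended
  -- by the facts X, hence not for Π₂ extended by them; a witness of this is an
  -- interpolant.
  ≡ᵤ⇒interpolant : ∀ Π₁ Π₂ → var Π₁ ⊆ˡ V → var Π₂ ⊆ˡ V → Π₁ ≡ᵤ Π₂ →
                   X <[ V ] Y → SE Π₁ X Y → Neg.¬ Neg.¬ Interpolant V Π₂ X Y
  ≡ᵤ⇒interpolant {V = V} {X = X} {Y} Π₁ Π₂ Π₁⊆V Π₂⊆V eq (X≤Y , Y≰X) (x , y) none =
    Y≰X (≤-resp (↾-≈ V Y) (↾-≈ V X) (⊆⇒≤ (least (X ↾ V)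
      (⊩-resp Π₁⊆V (≈-sym (↾-≈ V X)) (≈-sym (↾-≈ V Y)) x)
      (from (⊩-facts-members V X) (≈⇒≤ (≈-sym (↾-≈ V X))))
      (↾-mono X≤Y))))
    where
    y₂ : Y ⊩[ Y ] Π₂
    y₂ = ≡ᵤ⇒model Π₁ Π₂ Π₁⊆V Π₂⊆V eq y
    stable₂ : StableWith Π₂ (facts (members V X)) (Y ↾ V)
    stable₂ = ⊩-resp Π₂⊆V (≈-sym (↾-≈ V Y)) (≈-sym (↾-≈ V Y)) y₂
      , from (⊩-facts-members V X) (≤-resp (λ _ _ → refl) (≈-sym (↾-≈ V Y)) X≤Y)
      , λ J j jX J⊆Y → case ≤-dec V Y J of λ
          { (yes Y≤J) → ↾-least Y≤J
          ; (no Y≰J)  → Neg.contradiction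
              ( J , to (⊩-facts-members V X) jX
              , (≤-resp (λ _ _ → refl) (↾-≈ V Y) (⊆⇒≤ J⊆Y) , Y≰J)
              , ⊩-resp Π₂⊆V (λ _ _ → refl) (↾-≈ V Y) j , y₂) none }
    least = proj₂ (proj₂ (≡ₒ-++ {Y = Y ↾ V} Π₂ Π₁ (≡ᵤ-sym Π₁ Π₂ eq _ (facts-areFacts _)) stable₂))

  -- One half of the converse: the conditions on models and interpolants let
  -- stability under added facts pass from Π₁ to Π₂.
  ≡ᵤ-from : var Π₁ ⊆ˡ V → var Π₂ ⊆ˡ V →
            (∀ Y → Y ⊩[ Y ] Π₁ → Y ⊩[ Y ] Π₂) →
            (∀ X Y → X <[ V ] Y → SE Π₂ X Y → Interpolant V Π₁ X Y) →
            All IsFact Δ → StableWith Π₁ Δ Y → StableWith Π₂ Δ Y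
  ≡ᵤ-from {Π₁ = Π₁} {V} {Π₂} {Δ} {Y} Π₁⊆V Π₂⊆V model interpolant Δ-facts
    (m , mΔ , least) = model Y m , mΔ , least₂
    where
    least₂ : ∀ J → J ⊩[ Y ] Π₂ → J ⊩[ Y ] Δ → J ⊆ Y → Y ⊆ J
    least₂ J j jΔ J⊆Y with ≤-dec V Y J
    ... | yes Y≤J =
      least J (⊩-resp Π₁⊆V (≤-antisym Y≤J (⊆⇒≤ J⊆Y)) (λ _ _ → refl) m) jΔ J⊆Y
    ... | no Y≰J with Z , J≤Z , (Z≤Y , Y≰Z) , z , _ ←
                   interpolant J Y (⊆⇒≤ J⊆Y , Y≰J) (j , model Y m) =
      Neg.contradiction
        (≤-resp (λ _ _ → refl) (splice-≈ V Z Y) (⊆⇒≤ (least Z* z* zΔ Z*⊆Y))) Y≰Z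
      where
      -- Off V, Z may miss atoms that Δ adds as facts; Y contains them.
      Z* : Interp A
      Z* = splice V Z Y
      z* : Z* ⊩[ Y ] Π₁
      z* = ⊩-resp Π₁⊆V (≈-sym (splice-≈ V Z Y)) (λ _ _ → refl) z
      Z*⊆Y : Z* ⊆ Y
      Z*⊆Y p with p ∈? V
      ... | yes p∈V = Z≤Y p p∈V
      ... | no  _   = id
      J⊆Z* : J ⊆ Z*
      J⊆Z* p with p ∈? V
      ... | yes p∈V = J≤Z p p∈V
      ... | no  _   = J⊆Y p
      zΔ : Z* ⊩[ Y ] Δ
      zΔ r r∈Δ _ with All.lookup Δ-facts r∈Δ
      ... | p , refl = J⊆Z* p (jΔ r r∈Δ refl)

  -- Strong equivalence

  ≡ₛ-sym : ∀ (Π₁ Π₂ : Program A) → Π₁ ≡ₛ Π₂ → Π₂ ≡ₛ Π₁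
  ≡ₛ-sym Π₁ Π₂ eq Δ = ≡ₒ-sym (Π₁ ++ Δ) (Π₂ ++ Δ) (eq Δ)

  -- Below Y, the added facts and links have no models on V but X and Y.  The
  -- assumption that X fails the reduct of Π₂ therefore makes Y ↾ V stable for
  -- the extended Π₂, hence for the extended Π₁, and minimality forces X to
  -- equal Y on V.
  ≡ₛ⇒SE : ∀ Π₁ Π₂ → var Π₁ ⊆ˡ V → var Π₂ ⊆ˡ V → Π₁ ≡ₛ Π₂ →
          X ≤[ V ] Y → SE Π₁ X Y → SE Π₂ X Y
  ≡ₛ⇒SE {V = V} {X = X} {Y} Π₁ Π₂ Π₁⊆V Π₂⊆V eq X≤Y (x , y) =
    decidable-stable (⊩-dec Π₂ X Y) not-not-x₂ , y₂
    where
    y₂ : Y ⊩[ Y ] Π₂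
    y₂ = ≡ᵤ⇒model Π₁ Π₂ Π₁⊆V Π₂⊆V (λ Δ _ → eq Δ) y
    ΔX ΔL : Program A
    ΔX = facts (members V X)
    ΔL = links (members V Y) (nonmembers V X)
    not-not-x₂ : Neg.¬ Neg.¬ (X ⊩[ Y ] Π₂)
    not-not-x₂ ¬x₂ = ¬x₂ (⊩-resp Π₂⊆V (≤-antisym Y≤X X≤Y) (λ _ _ → refl) y₂)
      where
      stable₂ : StableWith Π₂ (ΔX ++ ΔL) (Y ↾ V)
      stable₂ = ⊩-resp Π₂⊆V (≈-sym (↾-≈ V Y)) (≈-sym (↾-≈ V Y)) y₂
        , from (⊩-++ ΔX)
            ( from (⊩-facts-members V X) (≤-resp (λ _ _ → refl) (≈-sym (↾-≈ V Y)) X≤Y)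
            , from (⊩-links-members V Y X) (inj₂ (≈⇒≤ (≈-sym (↾-≈ V Y)))))
        , λ J j jΔ J⊆Y → let jX , jL = to (⊩-++ ΔX) jΔ in
            case to (⊩-links-members V Y X) jL of λ
            { (inj₁ J≤X) → Neg.contradiction
                (⊩-resp Π₂⊆V (≤-antisym J≤X (to (⊩-facts-members V X) jX)) (↾-≈ V Y) j)
                ¬x₂
            ; (inj₂ Y≤J) → ↾-least Y≤J }
      Y≤X : Y ≤[ V ] X
      Y≤X = ≤-resp (↾-≈ V Y) (↾-≈ V X) (⊆⇒≤
        (proj₂ (proj₂ (≡ₒ-++ {Y = Y ↾ V} Π₂ Π₁ (≡ₛ-sym Π₁ Π₂ eq (ΔX ++ ΔL)) stable₂)) (X ↾ V)
          (⊩-resp Π₁⊆V (≈-sym (↾-≈ V X)) (≈-sym (↾-≈ V Y)) x)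
          (from (⊩-++ ΔX)
            ( from (⊩-facts-members V X) (≈⇒≤ (≈-sym (↾-≈ V X)))
            , from (⊩-links-members V Y X) (inj₁ (≈⇒≤ (↾-≈ V X)))))
          (↾-mono X≤Y)))

  SE⇒StableWith : (∀ X → X ⊆ Y → SE Π₁ X Y ⇔ SE Π₂ X Y) →
                  StableWith Π₁ Δ Y → StableWith Π₂ Δ Y
  SE⇒StableWith {Y = Y} se (m , mΔ , least) = m₂ , mΔ , λ J j jΔ J⊆Y →
    least J (proj₁ (from (se J J⊆Y) (j , m₂))) jΔ J⊆Y
    where m₂ = proj₂ (to (se Y λ _ → id) (m , m))

  ≡ₛ⇔ : var Π₁ ⊆ˡ V → var Π₂ ⊆ˡ V →
        Π₁ ≡ₛ Π₂ ⇔ (∀ X Y → X ≤[ V ] Y → SE Π₁ X Y ⇔ SE Π₂ X Y)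
  ≡ₛ⇔ {Π₁ = Π₁} {Π₂ = Π₂} Π₁⊆V Π₂⊆V = mk⇔
    (λ eq X Y X≤Y → mk⇔ (≡ₛ⇒SE Π₁ Π₂ Π₁⊆V Π₂⊆V eq X≤Y)
                        (≡ₛ⇒SE Π₂ Π₁ Π₂⊆V Π₁⊆V (≡ₛ-sym Π₁ Π₂ eq) X≤Y))
    (λ se Δ Y → mk⇔
      (from (Stable-++ _ _ Y)
        ∘ SE⇒StableWith (λ X X⊆Y → se X Y (⊆⇒≤ X⊆Y)) ∘ to (Stable-++ _ _ Y))
      (from (Stable-++ _ _ Y)
        ∘ SE⇒StableWith (λ X X⊆Y → ⇔-sym (se X Y (⊆⇒≤ X⊆Y))) ∘ to (Stable-++ _ _ Y)))

-- Truth of the encodings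

module Encodings {A : Set} (_≟_ : DecidableEquality A) where
  open Restriction _≟_
  open QBFSemantics (primed-≟ _≟_)
  open Truth (primed-≟ _≟_) using (⊨_)

  private
    variable
      V       : List A
      Π Π₁ Π₂ : Program A

  -- I with its unprimed, respectively doubly primed, part replaced.
  _[°≔_] _[″≔_] : Interp (Primed A) → Interp A → Interp (Primed A)
  (I [°≔ X ]) (p °) = X p
  (I [°≔ X ]) (p ′) = I (p ′)
  (I [°≔ X ]) (p ″) = I (p ″)
  (I [″≔ Z ]) (p °) = I (p °)
  (I [″≔ Z ]) (p ′) = I (p ′)
  (I [″≔ Z ]) (p ″) = Z p

  -- X on the atoms p and Y on the atoms p′; the atoms p″ are never free where
  -- this is used, and false is arbitrary.
  pair : Interp A → Interp A → Interp (Primed A)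
  pair X Y (p °) = X p
  pair X Y (p ′) = Y p
  pair X Y (p ″) = false

  embed-true : ∀ φ I → ⟦ embed φ ⟧ I ≡ true ⇔ eval I φ ≡ true
  embed-true φ I = mk⇔ (trans (sym (⟦embed⟧ φ I))) (trans (⟦embed⟧ φ I))

  -- The quantified atoms p are exactly those with p in V.  A witness X is
  -- therefore used on V only; elsewhere the unprimed part of I is kept.
  ∃V°-true : ∀ Π I → var Π ⊆ˡ V →
    ⟦ ∃⋆[ map _° V ] embed
        (V ⟨ _° < _′ ⟩ ∧ ⋀ (map (λ r → τ ⌜ B r ⌝ ⊃ τ ⌜ H r ⌝) Π)) ⟧ I ≡ true
    ⇔ (∃ λ X → X <[ V ] (I ∘ _′) × X ⊩[ I ∘ _′ ] Π)
  ∃V°-true {V = V} Π I Π⊆V = ⇔-trans (∃⋆-true (map _° V) (embed χ)) (mk⇔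
    (λ (J , off , h) →
      let J<I , j = to (matrix J) h
          J′≈I′ : ∀ {W} → (J ∘ _′) ≈[ W ] (I ∘ _′)
          J′≈I′ v _ = off (v ′) λ v′∈ → case ∈-map⁻ _° v′∈ of λ ()
      in J ∘ _° , <-resp (λ _ _ → refl) J′≈I′ J<I
                , ⊩-resp id (λ _ _ → refl) J′≈I′ j)
    (λ (X , X<I , x) → let X≈ = ≈-sym (splice-≈ V X (I ∘ _°)) in
      I [°≔ splice V X (I ∘ _°) ]
      , (λ { (p °) p∉ → splice-∉ X (I ∘ _°) (p∉ ∘ ∈-map⁺ _°)
           ; (p ′) _ → refl
           ; (p ″) _ → refl })
      , from (matrix _)
          (<-resp X≈ (λ _ _ → refl) X<I , ⊩-resp Π⊆V X≈ (λ _ _ → refl) x)))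
    where
    χ : Formula (Primed A)
    χ = V ⟨ _° < _′ ⟩ ∧ ⋀ (map (λ r → τ ⌜ B r ⌝ ⊃ τ ⌜ H r ⌝) Π)
    matrix : ∀ J → ⟦ embed χ ⟧ J ≡ true
             ⇔ ((J ∘ _°) <[ V ] (J ∘ _′) × (J ∘ _°) ⊩[ J ∘ _′ ] Π)
    matrix J = ⇔-trans (embed-true χ J)
      (⇔-trans (∧-true _ _) (eval-< V _° _′ J ×-⇔ τ-rules Π J))

  𝒮-true : ∀ Π I → var Π ⊆ˡ V → ⟦ 𝒮 V Π ⟧ I ≡ true ⇔ StableOn V Π (I ∘ _′)
  𝒮-true Π I Π⊆V = ⇔-trans (∧-true _ _)
    (⇔-trans (embed-true (rename _′ (hat Π)) I) (hat′-true Π I) ×-⇔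
     ⇔-trans (not-true _) (⇔-trans (¬-cong-⇔ (∃V°-true Π I Π⊆V)) (mk⇔
       (λ none X X<Y x → none (X , X<Y , x))
       (λ none (X , X<Y , x) → none X X<Y x))))

  ∃V″-true : ∀ Π I → var Π ⊆ˡ V →
    ⟦ ∃⋆[ map _″ V ] embed
        (V ⟨ _° ≤ _″ ⟩ ∧ V ⟨ _″ < _′ ⟩ ∧ τ″ (hat Π)) ⟧ I ≡ true
    ⇔ Interpolant V Π (I ∘ _°) (I ∘ _′)
  ∃V″-true {V = V} Π I Π⊆V = ⇔-trans (∃⋆-true (map _″ V) (embed χ)) (mk⇔
    (λ (J , off , h) →
      let I≤J , J<I , j = to (matrix J) h
          J°≈I° : (J ∘ _°) ≈[ V ] (I ∘ _°)
          J°≈I° v _ = off (v °) λ v°∈ → case ∈-map⁻ _″ v°∈ of λ ()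
          J′≈I′ : (J ∘ _′) ≈[ V ] (I ∘ _′)
          J′≈I′ v _ = off (v ′) λ v′∈ → case ∈-map⁻ _″ v′∈ of λ ()
      in J ∘ _″ , ≤-resp J°≈I° (λ _ _ → refl) I≤J
                , <-resp (λ _ _ → refl) J′≈I′ J<I
                , SE-resp Π⊆V (λ _ _ → refl) J′≈I′ j)
    (λ (Z , I≤Z , Z<I , z) → let Z≈ = ≈-sym (splice-≈ V Z (I ∘ _″)) in
      I [″≔ splice V Z (I ∘ _″) ]
      , (λ { (p °) _ → refl
           ; (p ′) _ → refl
           ; (p ″) p∉ → splice-∉ Z (I ∘ _″) (p∉ ∘ ∈-map⁺ _″) })
      , from (matrix _)
          ( ≤-resp (λ _ _ → refl) Z≈ I≤Z , <-resp Z≈ (λ _ _ → refl) Z<I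
          , SE-resp Π⊆V Z≈ (λ _ _ → refl) z)))
    where
    χ : Formula (Primed A)
    χ = V ⟨ _° ≤ _″ ⟩ ∧ V ⟨ _″ < _′ ⟩ ∧ τ″ (hat Π)
    matrix : ∀ J → ⟦ embed χ ⟧ J ≡ true
             ⇔ ((J ∘ _°) ≤[ V ] (J ∘ _″) × (J ∘ _″) <[ V ] (J ∘ _′)
                × SE Π (J ∘ _″) (J ∘ _′))
    matrix J = ⇔-trans (embed-true χ J)
      (⇔-trans (∧-true _ _) (eval-≤ V _° _″ J ×-⇔
        ⇔-trans (∧-true _ _) (eval-< V _″ _′ J ×-⇔
          ⇔-trans (mk⇔ (trans (sym (eval-rename _ (τ (hat Π)) J)))
                       (trans (eval-rename _ (τ (hat Π)) J)))
                  (τ-hat Π _))))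

  Interpolant-dec : var Π ⊆ˡ V → ∀ X Y → Dec (Interpolant V Π X Y)
  Interpolant-dec {Π = Π} Π⊆V X Y = Dec-map (∃V″-true Π (pair X Y) Π⊆V) (_ ≟ᵇ true)

  ℳ-true : ∀ Π₁ Π₂ I → var Π₂ ⊆ˡ V →
           ⟦ ℳ V (hat Π₁) (hat Π₂) ⟧ I ≡ true ⇔
           ((I ∘ _°) <[ V ] (I ∘ _′) → SE Π₁ (I ∘ _°) (I ∘ _′) →
            Interpolant V Π₂ (I ∘ _°) (I ∘ _′))
  ℳ-true {V = V} Π₁ Π₂ I Π₂⊆V = ⇔-trans (⊃-true _ _) (⇔-trans
    (→-cong-⇔
      (⇔-trans (embed-true (V ⟨ _° < _′ ⟩ ∧ τ (hat Π₁)) I)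
        (⇔-trans (∧-true _ _) (eval-< V _° _′ I ×-⇔ τ-hat Π₁ I)))
      (∃V″-true Π₂ I Π₂⊆V))
    (mk⇔ (λ h p q → h (p , q)) (λ h (p , q) → h p q)))

  hat°-true : ∀ Π I → ⟦ embed (rename _° (hat Π)) ⟧ I ≡ true ⇔ (I ∘ _°) ⊩[ I ∘ _° ] Π
  hat°-true Π I = ⇔-trans (embed-true (rename _° (hat Π)) I) (⇔-trans
    (mk⇔ (trans (sym (eval-rename _° (hat Π) I))) (trans (eval-rename _° (hat Π) I)))
    (hat⇔⊩ Π (I ∘ _°)))

  ≣-cong : ∀ {P Q : Set} Φ Ψ I → ⟦ Φ ⟧ I ≡ true ⇔ P → ⟦ Ψ ⟧ I ≡ true ⇔ Q →
           ⟦ Φ ≣ Ψ ⟧ I ≡ true ⇔ (P ⇔ Q)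
  ≣-cong Φ Ψ I p q = ⇔-trans (≣-true _ _)
    (mk⇔ (λ e → ⇔-trans (⇔-sym p) (⇔-trans e q))
         (λ e → ⇔-trans p (⇔-trans e (⇔-sym q))))

  -- The three equivalences as truth of QBFs

  ordinary : ∀ Π₁ Π₂ → var Π₁ ⊆ˡ V → var Π₂ ⊆ˡ V →
             Π₁ ≡ₒ Π₂ ⇔ ⊨ (∀⋆[ map _′ V ] 𝒮 V Π₁ ≣ 𝒮 V Π₂)
  ordinary {V = V} Π₁ Π₂ Π₁⊆V Π₂⊆V = ⇔-trans (≡ₒ⇔ Π₁⊆V Π₂⊆V) (⇔-trans
    (mk⇔ (λ h I → from (matrix I) (h (I ∘ _′)))
         (λ h Y → to (matrix (pair Y Y)) (h (pair Y Y))))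
    (⇔-sym (⊨∀⋆ (map _′ V) (𝒮 V Π₁ ≣ 𝒮 V Π₂))))
    where
    matrix : ∀ I → ⟦ 𝒮 V Π₁ ≣ 𝒮 V Π₂ ⟧ I ≡ true ⇔
                   (StableOn V Π₁ (I ∘ _′) ⇔ StableOn V Π₂ (I ∘ _′))
    matrix I = ≣-cong (𝒮 V Π₁) (𝒮 V Π₂) I (𝒮-true Π₁ I Π₁⊆V) (𝒮-true Π₂ I Π₂⊆V)

  ⊨∀⋆∀⋆ : ∀ P Q Φ → ⊨ (∀⋆[ P ] ∀⋆[ Q ] Φ) ⇔ (∀ I → ⟦ Φ ⟧ I ≡ true)
  ⊨∀⋆∀⋆ P Q Φ = ⇔-trans (⊨∀⋆ P (∀⋆[ Q ] Φ)) (∀⋆-true Q Φ)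

  uniform : ∀ Π₁ Π₂ → var Π₁ ⊆ˡ V → var Π₂ ⊆ˡ V →
            Π₁ ≡ᵤ Π₂ ⇔
            ⊨ (∀⋆[ map _° V ] ∀⋆[ map _′ V ]
                 (embed (rename _° (hat Π₁)) ≣ embed (rename _° (hat Π₂)))
                 ∧ ℳ V (hat Π₁) (hat Π₂)
                 ∧ ℳ V (hat Π₂) (hat Π₁))
  uniform {V = V} Π₁ Π₂ Π₁⊆V Π₂⊆V =
    ⇔-trans (mk⇔ forth back) (⇔-sym (⊨∀⋆∀⋆ (map _° V) (map _′ V) Ψ))
    where
    Ψ : QBF (Primed A)
    Ψ = (embed (rename _° (hat Π₁)) ≣ embed (rename _° (hat Π₂)))
        ∧ ℳ V (hat Π₁) (hat Π₂) ∧ ℳ V (hat Π₂) (hat Π₁)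
    Step : Program A → Program A → Interp A → Interp A → Set
    Step Π Π′ X Y = X <[ V ] Y → SE Π X Y → Interpolant V Π′ X Y
    matrix : ∀ I → ⟦ Ψ ⟧ I ≡ true ⇔
      ((((I ∘ _°) ⊩[ I ∘ _° ] Π₁) ⇔ ((I ∘ _°) ⊩[ I ∘ _° ] Π₂))
       × Step Π₁ Π₂ (I ∘ _°) (I ∘ _′) × Step Π₂ Π₁ (I ∘ _°) (I ∘ _′))
    matrix I = ⇔-trans (∧-true _ _)
      (≣-cong (embed (rename _° (hat Π₁))) (embed (rename _° (hat Π₂))) I
              (hat°-true Π₁ I) (hat°-true Π₂ I) ×-⇔
       ⇔-trans (∧-true _ _) (ℳ-true Π₁ Π₂ I Π₂⊆V ×-⇔ ℳ-true Π₂ Π₁ I Π₁⊆V))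
    forth : Π₁ ≡ᵤ Π₂ → ∀ I → ⟦ Ψ ⟧ I ≡ true
    forth eq I = from (matrix I)
      ( mk⇔ (≡ᵤ⇒model Π₁ Π₂ Π₁⊆V Π₂⊆V eq)
            (≡ᵤ⇒model Π₂ Π₁ Π₂⊆V Π₁⊆V (≡ᵤ-sym Π₁ Π₂ eq))
      , (λ X<Y se → decidable-stable (Interpolant-dec Π₂⊆V _ _)
          (≡ᵤ⇒interpolant Π₁ Π₂ Π₁⊆V Π₂⊆V eq X<Y se))
      , (λ X<Y se → decidable-stable (Interpolant-dec Π₁⊆V _ _)
          (≡ᵤ⇒interpolant Π₂ Π₁ Π₂⊆V Π₁⊆V (≡ᵤ-sym Π₁ Π₂ eq) X<Y se)))
    back : (∀ I → ⟦ Ψ ⟧ I ≡ true) → Π₁ ≡ᵤ Π₂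
    back h Δ Δ-facts Y = mk⇔
      (from (Stable-++ Π₂ Δ Y)
        ∘ ≡ᵤ-from Π₁⊆V Π₂⊆V (λ X → to (models X)) (λ X Y → proj₂ (steps X Y)) Δ-facts
        ∘ to (Stable-++ Π₁ Δ Y))
      (from (Stable-++ Π₁ Δ Y)
        ∘ ≡ᵤ-from Π₂⊆V Π₁⊆V (λ X → from (models X)) (λ X Y → proj₁ (steps X Y)) Δ-facts
        ∘ to (Stable-++ Π₂ Δ Y))
      where
      models : ∀ X → X ⊩[ X ] Π₁ ⇔ X ⊩[ X ] Π₂
      models X = proj₁ (to (matrix (pair X X)) (h (pair X X)))
      steps : ∀ X Y → Step Π₁ Π₂ X Y × Step Π₂ Π₁ X Y
      steps X Y = proj₂ (to (matrix (pair X Y)) (h (pair X Y)))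

  strong : ∀ Π₁ Π₂ → var Π₁ ⊆ˡ V → var Π₂ ⊆ˡ V →
           Π₁ ≡ₛ Π₂ ⇔
           ⊨ (∀⋆[ map _° V ] ∀⋆[ map _′ V ]
                embed (V ⟨ _° ≤ _′ ⟩) ⊃ (embed (τ (hat Π₁)) ≣ embed (τ (hat Π₂))))
  strong {V = V} Π₁ Π₂ Π₁⊆V Π₂⊆V = ⇔-trans (≡ₛ⇔ Π₁⊆V Π₂⊆V) (⇔-trans
    (mk⇔ (λ h I → from (matrix I) (h (I ∘ _°) (I ∘ _′)))
         (λ h X Y → to (matrix (pair X Y)) (h (pair X Y))))
    (⇔-sym (⊨∀⋆∀⋆ (map _° V) (map _′ V) Ψ)))
    where
    Ψ : QBF (Primed A)
    Ψ = embed (V ⟨ _° ≤ _′ ⟩) ⊃ (embed (τ (hat Π₁)) ≣ embed (τ (hat Π₂)))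
    matrix : ∀ I → ⟦ Ψ ⟧ I ≡ true ⇔ ((I ∘ _°) ≤[ V ] (I ∘ _′) →
               SE Π₁ (I ∘ _°) (I ∘ _′) ⇔ SE Π₂ (I ∘ _°) (I ∘ _′))
    matrix I = ⇔-trans (⊃-true _ _) (→-cong-⇔
      (⇔-trans (embed-true (V ⟨ _° ≤ _′ ⟩) I) (eval-≤ V _° _′ I))
      (≣-cong (embed (τ (hat Π₁))) (embed (τ (hat Π₂))) I
        (⇔-trans (embed-true (τ (hat Π₁)) I) (τ-hat Π₁ I))
        (⇔-trans (embed-true (τ (hat Π₂)) I) (τ-hat Π₂ I))))

var-⊆ˡ : ∀ (Π Δ : Program A) → var Π ⊆ˡ var (Π ++ Δ) × var Δ ⊆ˡ var (Π ++ Δ)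
var-⊆ˡ Π Δ rewrite concatMap-++ (λ r → atoms ⌜ H r ⌝ ++ atoms ⌜ B r ⌝) Π Δ =
  ∈-++⁺ˡ , ∈-++⁺ʳ (var Π)

corollary4 : {A : Set} (_≟_ : DecidableEquality A) (Π₁ Π₂ : Program A) →
    let open Truth (primed-≟ _≟_)
        V  = var (Π₁ ++ Π₂)
        V° = map _° V
        V′ = map _′ V
    in
    (Π₁ ≡ₒ Π₂ ⇔ ⊨ (∀⋆[ V′ ] 𝒮 V Π₁ ≣ 𝒮 V Π₂))
    × (Π₁ ≡ᵤ Π₂ ⇔
       ⊨ (∀⋆[ V° ] ∀⋆[ V′ ]
            (embed (rename _° (hat Π₁)) ≣ embed (rename _° (hat Π₂)))
            ∧ ℳ V (hat Π₁) (hat Π₂)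
            ∧ ℳ V (hat Π₂) (hat Π₁)))
    × (Π₁ ≡ₛ Π₂ ⇔
       ⊨ (∀⋆[ V° ] ∀⋆[ V′ ]
            embed (V ⟨ _° ≤ _′ ⟩) ⊃ (embed (τ (hat Π₁)) ≣ embed (τ (hat Π₂)))))
corollary4 _≟_ Π₁ Π₂ =
  ordinary Π₁ Π₂ Π₁⊆V Π₂⊆V , uniform Π₁ Π₂ Π₁⊆V Π₂⊆V , strong Π₁ Π₂ Π₁⊆V Π₂⊆V
  where
  open Encodings _≟_
  Π₁⊆V = proj₁ (var-⊆ˡ Π₁ Π₂)
  Π₂⊆V = proj₂ (var-⊆ˡ Π₁ Π₂)
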